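{- Let $G$ be a finite simple connected graph with at least two edges. Then the matching complex $M(G)$ is a connected graph if and only if $G$ is (up to isomorphism) in one of the families $\mathcal{G}_1$, $\mathcal{G}_2$, $\mathcal{G}_3$, or $G$ is the bowtie graph $B$.
   Context: A matching in $G$ is a set of edges no two of which share an endpoint. $M(G)$ is the simplicial complex whose faces are all matchings of $G$ (its vertices are the edges of $G$). "$M(G)$ is a connected graph" means that $M(G)$ is a simplicial complex of dimension at most one (no matching of size 3 exists in $G$) that is connected. Each family below is taken up to isomorphism and given by: vertices, required edges, optional edges (any subset may be included), and a set $U$ of vertices; one may moreover add any finite number (possibly zero) of new vertices, each joined to some nonempty subset of $U$ (and having no other neighbors). $\mathcal{G}_1$: vertices $1,\dots,5$; required $12,23,34,45$; optional $14,25$; $U=\{2,4\}$. $\mathcal{G}_2$: vertices $1,\dots,5$; required $12,23,13,34,45$; optional $14,24$; $U=\{4\}$. $\mathcal{G}_3$: vertices $1,\dots,5$; required $12,23,34,45,51$; optional $13,35,25,24,14$; $U=\emptyset$. Bowtie graph $B$: vertices $1,\dots,5$, edges $12,23,13,34,45,35$. -}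

module Defs where

open import Data.Empty using () renaming (⊥ to Empty)
open import Data.Fin using (Fin; _<_; _≟_)
open import Data.Fin.Patterns using (0F; 1F; 2F; 3F; 4F)
open import Data.Fin.Subset using (Subset; Nonempty; ⁅_⁆; _∪_; ⊥) renaming (_∈_ to _∈ˢ_; _⊆_ to _⊆ˢ_)
open import Data.Fin.Subset.Properties using () renaming (_∈?_ to _∈ˢ?_)
open import Data.List using (List; []; _∷_; _++_; length)
open import Data.List.Membership.Propositional using (_∈_)
open import Data.List.Relation.Binary.Subset.Propositional using (_⊆_)
open import Data.List.Relation.Unary.Any using (here)
open import Data.List.Relation.Unary.Unique.Propositional using (Unique)
open import Data.Nat using (ℕ; suc; _≤_)
open import Data.Product using (Σ-syntax; ∃; ∃₂; _×_; _,_; proj₁)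
open import Data.Product.Properties using (≡-dec)
open import Data.Sum using (_⊎_; inj₁; inj₂; swap)
open import Function using (_∘_)
open import Function.Bundles using (_↔_; _⇔_; Inverse)
open import Level using (0ℓ)
open import Relation.Binary using (Rel; Symmetric; Decidable)
open import Relation.Binary.Construct.Closure.ReflexiveTransitive using (Star)
open import Relation.Binary.PropositionalEquality using (_≡_; _≢_; refl; sym; trans)
open import Relation.Nullary using (¬_; no)
open import Relation.Nullary.Decidable using (_×-dec_; _⊎-dec_; ¬?)
open import Relation.Unary using (Pred)
import Data.List.Membership.DecPropositional as DecMembership

record Graph (V : Set) : Set₁ where
  infix 4 _~_ _~?_
  field
    _~_      : Rel V 0ℓ
    ~-sym    : Symmetric _~_
    ~-irrefl : ∀ {v} → ¬ (v ~ v)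
    _~?_     : Decidable _~_

Connected : {V : Set} → Graph V → Set
Connected G = ∀ u v → Star (Graph._~_ G) u v

infix 4 _≅_
record _≅_ {V W : Set} (G : Graph V) (H : Graph W) : Set where
  field
    bijection : V ↔ W
  open Inverse bijection using (to)
  field
    adjacency : ∀ u v → Graph._~_ G u v ⇔ Graph._~_ H (to u) (to v)

-- An undirected edge is represented by its unique increasing orientation.
-- The proofs are irrelevant, so _≡_ on edges is equality of the underlying
-- pairs of vertices.
record Edge {n : ℕ} (G : Graph (Fin n)) : Set where
  constructor edge
  field
    source target : Fin n
    .increasing   : source < target
    .adjacent     : Graph._~_ G source target

AtLeastTwoEdges : ∀ {n} → Graph (Fin n) → Set
AtLeastTwoEdges G = ∃₂ λ (e f : Edge G) → e ≢ f

-- A finite set of vertices is represented by any list enumerating it;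
-- closure under _⊆_ (inclusion of membership) makes Face independent of
-- order and repetitions.
record SimplicialComplex (V : Set) : Set₁ where
  field
    Face        : Pred (List V) 0ℓ
    face-empty  : Face []
    face-vertex : ∀ v → Face (v ∷ [])
    face-⊆      : ∀ {σ τ} → τ ⊆ σ → Face σ → Face τ

module _ {V : Set} (K : SimplicialComplex V) where
  open SimplicialComplex K

  -- Unique rules out repetitions, so that length is the cardinality.
  DimensionAtMost : ℕ → Set
  DimensionAtMost d = ∀ σ → Unique σ → Face σ → length σ ≤ suc d

  -- A complex is connected when its 1-skeleton is.
  ConnectedComplex : Set
  ConnectedComplex = ∀ v w → Star (λ x y → Face (x ∷ y ∷ [])) v w

  IsConnectedGraph : Set
  IsConnectedGraph = DimensionAtMost 1 × ConnectedComplex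

module _ {n : ℕ} {G : Graph (Fin n)} where

  EndpointOf : Fin n → Edge G → Set
  EndpointOf v e = v ≡ Edge.source e ⊎ v ≡ Edge.target e

  ShareEndpoint : Edge G → Edge G → Set
  ShareEndpoint e f = ∃ λ v → EndpointOf v e × EndpointOf v f

  IsMatching : Pred (List (Edge G)) 0ℓ
  IsMatching σ = ∀ {e f} → e ∈ σ → f ∈ σ → e ≢ f → ¬ ShareEndpoint e f

MatchingComplex : ∀ {n} (G : Graph (Fin n)) → SimplicialComplex (Edge G)
MatchingComplex G = record
  { Face        = IsMatching
  ; face-empty  = λ ()
  ; face-vertex = λ { v (here e≡v) (here f≡v) e≢f _ →
                      e≢f (trans e≡v (sym f≡v)) }
  ; face-⊆      = λ τ⊆σ m e∈τ f∈τ → m (τ⊆σ e∈τ) (τ⊆σ f∈τ)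
  }

-- The listed pairs are read as unordered, and loops are discarded.
fromEdges : ∀ {k} → List (Fin k × Fin k) → Graph (Fin k)
fromEdges es = record
  { _~_      = λ u v → u ≢ v × ((u , v) ∈ es ⊎ (v , u) ∈ es)
  ; ~-sym    = λ { (u≢v , uv) → u≢v ∘ sym , swap uv }
  ; ~-irrefl = λ uu → proj₁ uu refl
  ; _~?_     = λ u v →
      ¬? (u ≟ v) ×-dec (((u , v) ∈? es) ⊎-dec ((v , u) ∈? es))
  }
  where open DecMembership (≡-dec _≟_ _≟_) using (_∈?_)

-- Adjoins m pairwise non-adjacent new vertices, the j-th one having
-- neighbourhood N j.
module _ {k m : ℕ} (G : Graph (Fin k)) (N : Fin m → Subset k) where
  open Graph G

  ExtAdj : Rel (Fin k ⊎ Fin m) 0ℓ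
  ExtAdj (inj₁ u) (inj₁ v) = u ~ v
  ExtAdj (inj₁ u) (inj₂ j) = u ∈ˢ N j
  ExtAdj (inj₂ i) (inj₁ v) = v ∈ˢ N i
  ExtAdj (inj₂ i) (inj₂ j) = Empty

  ext-sym : Symmetric ExtAdj
  ext-sym {inj₁ _} {inj₁ _} p = ~-sym p
  ext-sym {inj₁ _} {inj₂ _} p = p
  ext-sym {inj₂ _} {inj₁ _} p = p

  ext-irrefl : ∀ {x} → ¬ ExtAdj x x
  ext-irrefl {inj₁ _} = ~-irrefl

  ext-dec : Decidable ExtAdj
  ext-dec (inj₁ u) (inj₁ v) = u ~? v
  ext-dec (inj₁ u) (inj₂ j) = u ∈ˢ? N j
  ext-dec (inj₂ i) (inj₁ v) = v ∈ˢ? N i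
  ext-dec (inj₂ i) (inj₂ j) = no λ ()

  extend : Graph (Fin k ⊎ Fin m)
  extend = record
    { _~_      = ExtAdj
    ; ~-sym    = λ {x} {y} → ext-sym {x} {y}
    ; ~-irrefl = λ {x} → ext-irrefl {x}
    ; _~?_     = ext-dec
    }

record Family : Set where
  field
    order             : ℕ
    required optional : List (Fin order × Fin order)
    U                 : Subset order

infix 4 _∈ᶠ_
_∈ᶠ_ : ∀ {n} → Graph (Fin n) → Family → Set
G ∈ᶠ F =
  Σ[ chosen ∈ List (Fin order × Fin order) ] chosen ⊆ optional ×
  Σ[ m ∈ ℕ ] Σ[ N ∈ (Fin m → Subset order) ]
    (∀ j → Nonempty (N j) × N j ⊆ˢ U) ×
    G ≅ extend (fromEdges (required ++ chosen)) N
  where open Family F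

pattern v₁ = 0F
pattern v₂ = 1F
pattern v₃ = 2F
pattern v₄ = 3F
pattern v₅ = 4F

𝒢₁ 𝒢₂ 𝒢₃ : Family

𝒢₁ = record
  { order    = 5
  ; required = (v₁ , v₂) ∷ (v₂ , v₃) ∷ (v₃ , v₄) ∷ (v₄ , v₅) ∷ []
  ; optional = (v₁ , v₄) ∷ (v₂ , v₅) ∷ []
  ; U        = ⁅ v₂ ⁆ ∪ ⁅ v₄ ⁆
  }

𝒢₂ = record
  { order    = 5
  ; required = (v₁ , v₂) ∷ (v₂ , v₃) ∷ (v₁ , v₃) ∷ (v₃ , v₄) ∷ (v₄ , v₅) ∷ []
  ; optional = (v₁ , v₄) ∷ (v₂ , v₄) ∷ []
  ; U        = ⁅ v₄ ⁆
  }

𝒢₃ = record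
  { order    = 5
  ; required = (v₁ , v₂) ∷ (v₂ , v₃) ∷ (v₃ , v₄) ∷ (v₄ , v₅) ∷ (v₅ , v₁) ∷ []
  ; optional = (v₁ , v₃) ∷ (v₃ , v₅) ∷ (v₂ , v₅) ∷ (v₂ , v₄) ∷ (v₁ , v₄) ∷ []
  ; U        = ⊥
  }

bowtie : Graph (Fin 5)
bowtie = fromEdges
  ((v₁ , v₂) ∷ (v₂ , v₃) ∷ (v₁ , v₃) ∷ (v₃ , v₄) ∷ (v₄ , v₅) ∷ (v₃ , v₅) ∷ [])

{-# OPTIONS --safe #-}
-- M(G) is a connected graph iff G has no three disjoint edges and any property
-- of edges that passes to disjoint edges spreads from one edge to all of them.
-- If so, G contains a path on five vertices: G is connected, so two disjoint
-- edges lie on a path with four or five vertices; in the former case, unless a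
-- fifth vertex extends the path or its closure to a 4-cycle, the middle edge
-- and the closing edge form a union of components of M(G).  Excluding
-- three-matchings, the vertices outside a path abcde are pairwise non-adjacent
-- and adjacent to b and d only, so G is determined by the six possible chords
-- of the path: a Hamiltonian cycle of abcde gives 𝒢₃, and the remaining chord
-- sets give 𝒢₁, 𝒢₂, the bowtie, or make bd isolated in M(G).
-- Conversely, an edge of a member of a family is disjoint from another one
-- depending only on the vertices 1,…,5 it contains, so a finite computation
-- on these traces suffices.
module Submission where

open import Data.Empty using (⊥; ⊥-elim; ⊥-elim-irr)
open import Data.Fin using (Fin; zero; suc; _<_; _<?_; _≟_)
open import Data.Fin.Patterns using (0F; 1F; 2F; 3F; 4F)
open import Data.Fin.Properties using (<-cmp; <-asym; any?; all?)
open import Data.Fin.Subset using (Subset; Nonempty) renaming (_∈_ to _∈ˢ_; _⊆_ to _⊆ˢ_; ⊥ to ∅)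
open import Data.Fin.Subset.Properties using (∉⊥) renaming (_∈?_ to _∈ˢ?_)
open import Data.List using (List; []; _∷_; _++_; map; filter; allFin; cartesianProduct; length)
import Data.List as List
open import Data.List.Membership.Propositional using (_∈_; find)
open import Data.List.Membership.Propositional.Properties
  using (∈-++⁺ˡ; ∈-++⁺ʳ; ∈-++⁻; ∈-map⁺; ∈-filter⁺; ∈-filter⁻; ∈-allFin; ∈-lookup; ∈-cartesianProduct⁺)
open import Data.List.Relation.Unary.All as All using (All; []; _∷_)
open import Data.List.Relation.Unary.AllPairs using ([]; _∷_)
open import Data.List.Relation.Unary.Any as Any using (Any; here; there; index)
open import Data.List.Relation.Unary.Any.Properties using (lookup-index)
open import Data.List.Relation.Unary.Unique.Propositional using (Unique)
open import Data.List.Relation.Unary.Unique.Propositional.Properties using (allFin⁺; filter⁺)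
open import Data.Nat using (ℕ; zero; suc; _≤_; z≤n; s≤s)
open import Data.Product using (∃; _×_; _,_; proj₁; proj₂; swap)
open import Data.Product.Properties using (≡-dec)
open import Data.Sum using (_⊎_; inj₁; inj₂; [_,_]′)
import Data.Sum as Sum
open import Data.Sum.Properties using (inj₁-injective)
open import Data.Vec.Relation.Unary.All using ([]; _∷_)
import Data.Vec.Relation.Unary.AllPairs as VecPairs
open import Data.Vec.Relation.Unary.Unique.Propositional.Properties
  using () renaming (lookup-injective to vec-lookup-injective)
open import Data.Vec using (Vec; []; _∷_; lookup; tabulate)
open import Data.Vec.Properties using (lookup∘tabulate; []=⇒lookup; lookup⇒[]=)
open import Function using (_∘_; id)
open import Function.Bundles using (_↔_; _⇔_; mk⇔; mk⤖; Inverse; Equivalence; mk↔ₛ′)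
open import Function.Construct.Symmetry using (↔-sym)
open import Function.Properties.Bijection using (⤖⇒↔)
open import Relation.Binary using (tri<; tri≈; tri>)
open import Relation.Binary.Construct.Closure.ReflexiveTransitive as Star using (Star; ε; _◅_; _◅◅_)
open import Relation.Binary.PropositionalEquality
  using (_≡_; _≢_; refl; sym; trans; cong; subst; subst₂; ≢-sym)
open import Relation.Nullary using (¬_; Dec; yes; no; contradiction)
open import Relation.Nullary.Reflects using (Reflects; invert)
open import Relation.Nullary.Decidable
  using (True; toWitness; from-yes; map′; recompute; does; proof; dec-true; _×-dec_; _⊎-dec_; _→-dec_; ¬?)
import Data.List.Membership.DecPropositional as DecMembership
open import Defs

-- Edges as pairs of endpoints, in either order.

infix 4 _∈ₑ_
_∈ₑ_ : {V : Set} → V → V × V → Set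
v ∈ₑ (x , y) = v ≡ x ⊎ v ≡ y

Disjoint : {V : Set} → V × V → V × V → Set
Disjoint p q = ∀ {v} → v ∈ₑ p → v ∈ₑ q → ⊥

Disjoint-sym : ∀ {V : Set} {p q : V × V} → Disjoint p q → Disjoint q p
Disjoint-sym dis v∈q v∈p = dis v∈p v∈q

∈ₑ-swap : ∀ {V : Set} {v : V} p → v ∈ₑ p → v ∈ₑ swap p
∈ₑ-swap _ = Sum.swap

_∈ₑ?_ : ∀ {k} (v : Fin k) p → Dec (v ∈ₑ p)
v ∈ₑ? (x , y) = (v ≟ x) ⊎-dec (v ≟ y)

disjoint? : ∀ {k} (p q : Fin k × Fin k) → Dec (Disjoint p q)
disjoint? (x , y) q =
  map′ (λ { (x∉q , y∉q) (inj₁ refl) → x∉q ; (x∉q , y∉q) (inj₂ refl) → y∉q })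
       (λ dis → dis (inj₁ refl) , dis (inj₂ refl))
       (¬? (x ∈ₑ? q) ×-dec ¬? (y ∈ₑ? q))

Same : {V : Set} → V × V → V × V → Set
Same p q = p ≡ q ⊎ p ≡ swap q

Same-swap : ∀ {V : Set} {p q : V × V} → Same p q → Same (swap p) q
Same-swap (inj₁ refl) = inj₂ refl
Same-swap (inj₂ refl) = inj₁ refl

Same-sym : ∀ {V : Set} {p q : V × V} → Same p q → Same q p
Same-sym (inj₁ refl) = inj₁ refl
Same-sym (inj₂ refl) = inj₂ refl

Same-trans : ∀ {V : Set} {p q r : V × V} → Same p q → Same q r → Same p r
Same-trans (inj₁ refl) q≈r = q≈r
Same-trans (inj₂ refl) q≈r = Same-swap q≈r

∈ₑ-Same : ∀ {V : Set} {v : V} {p q} → Same p q → v ∈ₑ p → v ∈ₑ q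
∈ₑ-Same (inj₁ refl) v∈p = v∈p
∈ₑ-Same {q = q} (inj₂ refl) v∈p = ∈ₑ-swap (swap q) v∈p

Disjoint-Same : ∀ {V : Set} {p p′ q q′ : V × V} →
  Same p p′ → Same q q′ → Disjoint p′ q′ → Disjoint p q
Disjoint-Same p≈p′ q≈q′ dis v∈p v∈q = dis (∈ₑ-Same p≈p′ v∈p) (∈ₑ-Same q≈q′ v∈q)

Adj : {V : Set} → Graph V → V × V → Set
Adj G (x , y) = Graph._~_ G x y

Adj-swap : ∀ {V : Set} (G : Graph V) {p} → Adj G p → Adj G (swap p)
Adj-swap G = Graph.~-sym G

Adj-Same : ∀ {V : Set} (G : Graph V) {p q} → Same p q → Adj G q → Adj G p
Adj-Same G (inj₁ refl) = id
Adj-Same G (inj₂ refl) = Adj-swap G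

~⇒≢ : ∀ {V : Set} (G : Graph V) {x y} → Graph._~_ G x y → x ≢ y
~⇒≢ G x~x refl = Graph.~-irrefl G x~x

NoThreeMatching : {V : Set} → Graph V → Set
NoThreeMatching G = ∀ {p q r} → Adj G p → Adj G q → Adj G r →
  Disjoint p q → Disjoint p r → Disjoint q r → ⊥

-- Connectedness of M(G), as an induction principle.
MatchingInduction : {V : Set} → Graph V → Set₁
MatchingInduction {V} G = (P : V × V → Set) → (∀ {p} → P p → P (swap p)) →
  (∀ {p q} → P p → Adj G p → Adj G q → Disjoint p q → P q) →
  ∀ {p q} → Adj G p → P p → Adj G q → P q

-- The matching complex in terms of disjoint pairs of endpoints.

module _ {n : ℕ} {G : Graph (Fin n)} where
  open Graph G

  ends : Edge G → Fin n × Fin n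
  ends e = Edge.source e , Edge.target e

  -- An edge stores its adjacency irrelevantly; decidability of `_~_` recovers a usable proof.
  ends-adj : ∀ e → Adj G (ends e)
  ends-adj (edge x y _ x~y) = recompute (x ~? y) x~y

  ends-injective : ∀ {e f} → ends e ≡ ends f → e ≡ f
  ends-injective {edge _ _ _ _} {edge _ _ _ _} refl = refl

  -- Both orientations are increasing, so neither can be the reverse of the other.
  Same-ends : ∀ {e f} → Same (ends e) (ends f) → e ≡ f
  Same-ends (inj₁ eq) = ends-injective eq
  Same-ends {edge _ _ s<t _} {edge _ _ t<s _} (inj₂ refl) = ⊥-elim-irr (<-asym s<t t<s)

  _≟ₑ_ : (e f : Edge G) → Dec (e ≡ f)
  e ≟ₑ f = map′ ends-injective (cong ends) (≡-dec _≟_ _≟_ (ends e) (ends f))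

  orient : ∀ {p} → Adj G p → ∃ λ e → Same (ends e) p
  orient {x , y} x~y with <-cmp x y
  ... | tri< x<y _ _ = edge x y x<y x~y , inj₁ refl
  ... | tri≈ _ x≡y _ = contradiction x≡y (~⇒≢ G x~y)
  ... | tri> _ _ y<x = edge y x y<x (~-sym x~y) , inj₂ refl

  disjoint⇒≢ : ∀ {e f} → Disjoint (ends e) (ends f) → e ≢ f
  disjoint⇒≢ dis refl = dis (inj₁ refl) (inj₁ refl)

  disjoint⇒unshared : ∀ {e f : Edge G} → Disjoint (ends e) (ends f) → ¬ ShareEndpoint e f
  disjoint⇒unshared dis (_ , v∈e , v∈f) = dis v∈e v∈f

  disjoint⇒face : ∀ {e f} → Disjoint (ends e) (ends f) → IsMatching (e ∷ f ∷ [])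
  disjoint⇒face dis (here refl) (here refl) e≢f _ = e≢f refl
  disjoint⇒face {e} {f} dis (here refl) (there (here refl)) _ = disjoint⇒unshared {e} {f} dis
  disjoint⇒face {e} {f} dis (there (here refl)) (here refl) _ =
    disjoint⇒unshared {f} {e} (Disjoint-sym {p = ends e} dis)
  disjoint⇒face dis (there (here refl)) (there (here refl)) e≢f _ = e≢f refl

  face⇒disjoint : ∀ {σ e f} → IsMatching σ → e ∈ σ → f ∈ σ → e ≢ f → Disjoint (ends e) (ends f)
  face⇒disjoint match e∈σ f∈σ e≢f v∈e v∈f = match e∈σ f∈σ e≢f (_ , v∈e , v∈f)

  dimension⇒noThreeMatching : DimensionAtMost (MatchingComplex G) 1 → NoThreeMatching G
  dimension⇒noThreeMatching dim {p} {q} {r} p~ q~ r~ p⊥q p⊥r q⊥r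
    with e , e≈p ← orient p~ | f , f≈q ← orient q~ | g , g≈r ← orient r~ =
    3≰2 (dim (e ∷ f ∷ g ∷ [])
      ((disjoint⇒≢ {e} {f} e⊥f ∷ disjoint⇒≢ {e} {g} e⊥g ∷ []) ∷
       (disjoint⇒≢ {f} {g} f⊥g ∷ []) ∷ [] ∷ [])
      face)
    where
    e⊥f = Disjoint-Same e≈p f≈q p⊥q
    e⊥g = Disjoint-Same e≈p g≈r p⊥r
    f⊥g = Disjoint-Same f≈q g≈r q⊥r

    3≰2 : ¬ (3 ≤ 2)
    3≰2 (s≤s (s≤s ()))

    face : IsMatching (e ∷ f ∷ g ∷ [])
    face (here refl) (here refl) e≢e = contradiction refl e≢e
    face (here refl) (there (here refl)) _ = disjoint⇒unshared {e} {f} e⊥f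
    face (here refl) (there (there (here refl))) _ = disjoint⇒unshared {e} {g} e⊥g
    face (there (here refl)) (here refl) _ (v , v∈f , v∈e) = e⊥f v∈e v∈f
    face (there (here refl)) (there (here refl)) f≢f = contradiction refl f≢f
    face (there (here refl)) (there (there (here refl))) _ = disjoint⇒unshared {f} {g} f⊥g
    face (there (there (here refl))) (here refl) _ (v , v∈g , v∈e) = e⊥g v∈e v∈g
    face (there (there (here refl))) (there (here refl)) _ (v , v∈g , v∈f) = f⊥g v∈f v∈g
    face (there (there (here refl))) (there (there (here refl))) g≢g = contradiction refl g≢g

  noThreeMatching⇒dimension : NoThreeMatching G → DimensionAtMost (MatchingComplex G) 1
  noThreeMatching⇒dimension no3 [] _ _ = z≤n
  noThreeMatching⇒dimension no3 (_ ∷ []) _ _ = s≤s z≤n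
  noThreeMatching⇒dimension no3 (_ ∷ _ ∷ []) _ _ = s≤s (s≤s z≤n)
  noThreeMatching⇒dimension no3 (e ∷ f ∷ g ∷ _) ((e≢f ∷ e≢g ∷ _) ∷ (f≢g ∷ _) ∷ _) match =
    ⊥-elim (no3 (ends-adj e) (ends-adj f) (ends-adj g)
      (face⇒disjoint match (here refl) (there (here refl)) e≢f)
      (face⇒disjoint match (here refl) (there (there (here refl))) e≢g)
      (face⇒disjoint match (there (here refl)) (there (there (here refl))) f≢g))

  connected⇒matchingInduction : ConnectedComplex (MatchingComplex G) → MatchingInduction G
  connected⇒matchingInduction conn P P-swap step {p} {q} p~ Pp q~
    with e , e≈p ← orient p~ | f , f≈q ← orient q~ =
    resp (Same-sym f≈q) (walk (conn e f) (resp e≈p Pp))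
    where
    resp : ∀ {p q} → Same p q → P q → P p
    resp (inj₁ refl) = id
    resp (inj₂ refl) = P-swap

    walk : ∀ {e f} → Star (λ x y → IsMatching (x ∷ y ∷ [])) e f → P (ends e) → P (ends f)
    walk ε Pe = Pe
    -- A list repeating `e` is still a face, so a step may stay at `e`; only a proper step gives
    -- disjoint edges.
    walk {e} (_◅_ {j = g} face path) Pe with e ≟ₑ g
    ... | yes refl = walk path Pe
    ... | no  e≢g  = walk path (step Pe (ends-adj e) (ends-adj g)
                       (face⇒disjoint face (here refl) (there (here refl)) e≢g))

-- Presentations of the members of a family.

module _ (F : Family) where
  open Family F
  open DecMembership (≡-dec (_≟_ {order}) (_≟_ {order})) using (_∈?_)

  Pair : Set
  Pair = Fin order × Fin order

  Listed : Pair → Set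
  Listed p = p ∈ required ++ optional ⊎ swap p ∈ required ++ optional

  -- Increasing pairs only, so that `present` asks for each non-edge once.
  forbidden : List Pair
  forbidden =
    filter (λ p → ¬? ((p ∈? required ++ optional) ⊎-dec (swap p ∈? required ++ optional)))
      (filter (λ p → proj₁ p <? proj₂ p) (cartesianProduct (allFin order) (allFin order)))

  listed⊎forbidden : ∀ {i j} → i < j → Listed (i , j) ⊎ (i , j) ∈ forbidden
  listed⊎forbidden {i} {j} i<j
    with ((i , j) ∈? required ++ optional) ⊎-dec ((j , i) ∈? required ++ optional)
  ... | yes listed = inj₁ listed
  ... | no ¬listed =
    inj₂ (∈-filter⁺ _ (∈-filter⁺ _ (∈-cartesianProduct⁺ (∈-allFin i) (∈-allFin j)) i<j) ¬listed)

  -- The loop (u , u) stands for an edge from u to a vertex outside 1,…,order.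
  traces : List Pair
  traces = (required ++ optional) ++ map (λ u → u , u) (filter (_∈ˢ? U) (allFin order))

  -- Walks in the matching complex that pass through required edges only, since these occur in every
  -- member whatever optional edges are chosen. The number bounds the length and keeps the search
  -- decidable.
  mutual
    Leads : ℕ → Pair → Pair → Set
    Leads k root t = Any (λ r → Disjoint t r × Reaches k root r) required

    Reaches : ℕ → Pair → Pair → Set
    Reaches zero    root r = r ≡ root
    Reaches (suc k) root r = r ≡ root ⊎ Leads k root r

  mutual
    leads? : ∀ k root t → Dec (Leads k root t)
    leads? k root t = Any.any? (λ r → disjoint? t r ×-dec reaches? k root r) required

    reaches? : ∀ k root r → Dec (Reaches k root r)
    reaches? zero    root r = ≡-dec _≟_ _≟_ r root
    reaches? (suc k) root r = ≡-dec _≟_ _≟_ r root ⊎-dec leads? k root r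

  TracesReach : ℕ → Pair → Set
  TracesReach k root = All (Leads k root) traces

  tracesReach? : ∀ k root → Dec (TracesReach k root)
  tracesReach? k root = All.all? (leads? k root) traces

  NoThreeTraces : Set
  NoThreeTraces = All (λ p → All (λ q → All (λ r →
    ¬ (Disjoint p q × Disjoint p r × Disjoint q r)) traces) traces) traces

  noThreeTraces? : Dec NoThreeTraces
  noThreeTraces? =
    All.all? (λ p → All.all? (λ q → All.all? (λ r →
      ¬? (disjoint? p q ×-dec disjoint? p r ×-dec disjoint? q r)) traces) traces) traces

  module _ {n : ℕ} (G : Graph (Fin n)) where
    open Graph G

    -- Membership in `F` phrased inside `G`, with no isomorphism and no choice of optional edges:
    -- these are simply the optional pairs that `ι` sends to edges.
    record Presentation : Set where
      field
        ι           : Fin order → Fin n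
        ι-injective : ∀ {i j} → ι i ≡ ι j → i ≡ j

      Outside : Fin n → Set
      Outside w = ∀ i → w ≢ ι i

      field
        adj-required : ∀ {i j} → (i , j) ∈ required → ι i ~ ι j
        adj-listed   : ∀ {i j} → ι i ~ ι j → Listed (i , j)
        independent  : ∀ {w w′} → Outside w → Outside w′ → ¬ (w ~ w′)
        attached-U   : ∀ {w i} → Outside w → w ~ ι i → i ∈ˢ U
        attached     : ∀ {w} → Outside w → ∃ λ i → w ~ ι i

lookup-injective : ∀ {A : Set} {xs : List A} → Unique xs →
  ∀ {i j} → List.lookup xs i ≡ List.lookup xs j → i ≡ j
lookup-injective (_  ∷ _)   {zero}  {zero}  _  = refl
lookup-injective (x∉ ∷ _)   {zero}  {suc j} eq = contradiction eq (All.lookup x∉ (∈-lookup j))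
lookup-injective (x∉ ∷ _)   {suc i} {zero}  eq = contradiction (sym eq) (All.lookup x∉ (∈-lookup i))
lookup-injective (_  ∷ xs!) {suc i} {suc j} eq = cong suc (lookup-injective xs! eq)

-- Traces of edges on an embedded vertex set.

module Image {k n : ℕ} (ι : Fin k → Fin n) where

  Outside : Fin n → Set
  Outside w = ∀ i → w ≢ ι i

  image : Fin k × Fin k → Fin n × Fin n
  image (i , j) = ι i , ι j

  outside? : ∀ w → Dec (Outside w)
  outside? w = all? (λ i → ¬? (w ≟ ι i))

  image⊎outside : ∀ w → (∃ λ i → ι i ≡ w) ⊎ Outside w
  image⊎outside w with any? (λ i → ι i ≟ w)
  ... | yes found = inj₁ found
  ... | no ¬found = inj₂ (λ i w≡ιi → ¬found (i , sym w≡ιi))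

  -- Only sets of endpoints are compared, so orientation is immaterial and `(i , i)` can be the
  -- trace of an edge with one end outside.
  Traces : Fin n × Fin n → Fin k × Fin k → Set
  Traces p t = ∀ {i} → ι i ∈ₑ p ⇔ i ∈ₑ t

  module _ (ι-injective : ∀ {i j} → ι i ≡ ι j → i ≡ j) where

    traces-image : ∀ {t} → Traces (image t) t
    traces-image = mk⇔ (Sum.map ι-injective ι-injective) (Sum.map (cong ι) (cong ι))

    traces-outside : ∀ {w i} → Outside w → Traces (w , ι i) (i , i)
    traces-outside out = mk⇔
      [ (λ ιj≡w → contradiction (sym ιj≡w) (out _)) , inj₁ ∘ ι-injective ]′
      (λ { (inj₁ refl) → inj₂ refl ; (inj₂ refl) → inj₂ refl })

  traces-Same : ∀ {p q t} → Same p q → Traces q t → Traces p t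
  traces-Same p≈q tr = mk⇔
    (Equivalence.to tr ∘ ∈ₑ-Same p≈q) (∈ₑ-Same (Same-sym p≈q) ∘ Equivalence.from tr)

  traces-disjoint : ∀ {p q t u} → Traces p t → Traces q u → Disjoint p q → Disjoint t u
  traces-disjoint pt qu dis i∈t i∈u = dis (Equivalence.from pt i∈t) (Equivalence.from qu i∈u)

  -- A common vertex would lie in the range of `ι`, where `t` records all of `p`. For two arbitrary
  -- edges this fails, as they may meet outside.
  disjoint-image : ∀ {p t u} → Traces p t → Disjoint t u → Disjoint p (image u)
  disjoint-image pt dis v∈p (inj₁ refl) = dis (Equivalence.to pt v∈p) (inj₁ refl)
  disjoint-image pt dis v∈p (inj₂ refl) = dis (Equivalence.to pt v∈p) (inj₂ refl)

-- Consequences of a presentation.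

module _ {F : Family} {n : ℕ} {G : Graph (Fin n)} (pres : Presentation F G) where
  open Family F
  open Graph G
  open Presentation pres
  open Image ι hiding (Outside)

  -- Outside vertices are independent, so every edge has an end in the range of `ι`.
  edge-trace : ∀ {p} → Adj G p → ∃ λ t → t ∈ traces F × Traces p t
  edge-trace {x , y} x~y with image⊎outside x | image⊎outside y
  ... | inj₁ (i , refl) | inj₁ (j , refl) with adj-listed x~y
  ...   | inj₁ ij = (i , j) , ∈-++⁺ˡ ij , traces-image ι-injective
  ...   | inj₂ ji = (j , i) , ∈-++⁺ˡ ji , traces-Same (inj₂ refl) (traces-image ι-injective)
  edge-trace x~y | inj₁ (i , refl) | inj₂ y-out =
    (i , i) , ∈-++⁺ʳ _ (∈-map⁺ _ (∈-filter⁺ _ (∈-allFin i) (attached-U y-out (~-sym x~y)))) ,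
    traces-Same (inj₂ refl) (traces-outside ι-injective y-out)
  edge-trace x~y | inj₂ x-out | inj₁ (j , refl) =
    (j , j) , ∈-++⁺ʳ _ (∈-map⁺ _ (∈-filter⁺ _ (∈-allFin j) (attached-U x-out x~y))) ,
    traces-outside ι-injective x-out
  edge-trace x~y | inj₂ x-out | inj₂ y-out = contradiction x~y (independent x-out y-out)

  -- Disjoint edges have disjoint traces, so a three-matching would show among the finitely many
  -- traces.
  presentation⇒noThreeMatching : NoThreeTraces F → NoThreeMatching G
  presentation⇒noThreeMatching no3 p~ q~ r~ p⊥q p⊥r q⊥r
    with t , t∈ , pt ← edge-trace p~ | u , u∈ , qu ← edge-trace q~ | v , v∈ , rv ← edge-trace r~ =
    All.lookup (All.lookup (All.lookup no3 t∈) u∈) v∈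
      ( traces-disjoint {t = t} {u} pt qu p⊥q
      , traces-disjoint {t = t} {v} pt rv p⊥r
      , traces-disjoint {t = u} {v} qu rv q⊥r)

  -- Each edge has a walk to the root edge; two edges are joined by one such walk and the reverse of
  -- another.
  presentation⇒connected : ∀ k {root} → root ∈ required → TracesReach F k root →
    ConnectedComplex (MatchingComplex G)
  presentation⇒connected k {root} root∈ reach e f =
    to-root e ◅◅ Star.reverse face-sym (to-root f)
    where
    Face : Edge G → Edge G → Set
    Face e f = IsMatching (e ∷ f ∷ [])

    face-sym : ∀ {e f} → Face e f → Face f e
    face-sym face = SimplicialComplex.face-⊆ (MatchingComplex G)
      (λ { (here refl) → there (here refl) ; (there (here refl)) → here refl }) face

    root-edge : Edge G
    root-edge = proj₁ (orient (adj-required root∈))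

    mutual
      leads : ∀ k {e t} → Traces (ends e) t → Leads F k root t → Star Face e root-edge
      leads k {e} {t} et found with r , r∈ , t⊥r , r-reaches ← find found
        with g , g≈r ← orient {G = G} (adj-required r∈) =
        disjoint⇒face {e = e} {g} (Disjoint-Same (inj₁ refl) g≈r (disjoint-image {t = t} {r} et t⊥r)) ◅
        reaches k g≈r r-reaches

      reaches : ∀ k {e r} → Same (ends e) (image r) → Reaches F k root r → Star Face e root-edge
      reaches zero    e≈r refl = arrived e≈r
      reaches (suc k) e≈r (inj₁ refl) = arrived e≈r
      reaches (suc k) {r = r} e≈r (inj₂ r-leads) =
        leads k {t = r} (traces-Same e≈r (traces-image ι-injective)) r-leads

      arrived : ∀ {e} → Same (ends e) (image root) → Star Face e root-edge
      arrived {e} e≈root = subst (Star Face e)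
        (Same-ends (Same-trans e≈root (Same-sym (proj₂ (orient (adj-required root∈)))))) ε

    to-root : ∀ e → Star Face e root-edge
    to-root e with t , t∈ , et ← edge-trace (ends-adj e) = leads k {t = t} et (All.lookup reach t∈)

  -- All data are read off from `G`: optional pairs that are edges are chosen, the vertices outside
  -- the range of `ι` are enumerated as new vertices, and adjacency defines their neighbourhoods
  -- `N`.
  presentation⇒∈ᶠ : G ∈ᶠ F
  presentation⇒∈ᶠ =
    chosen , (λ p∈ → proj₁ (∈-filter⁻ chosen? {xs = optional} p∈)) ,
    length outsiders , N , (λ j → N-nonempty j , λ {i} → N⊆U j {i}) ,
    record { bijection = ↔-sym bij ; adjacency = adjacency }
    where
    chosen? : ∀ p → Dec (Adj G (image p))
    chosen? (i , j) = ι i ~? ι j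

    chosen : List (Fin order × Fin order)
    chosen = filter chosen? optional

    outsiders : List (Fin n)
    outsiders = filter outside? (allFin n)

    outsider : Fin (length outsiders) → Fin n
    outsider = List.lookup outsiders

    outsider-outside : ∀ j → Outside (outsider j)
    outsider-outside j = proj₂ (∈-filter⁻ outside? {xs = allFin n} (∈-lookup j))

    N : Fin (length outsiders) → Subset order
    N j = tabulate (λ i → does (outsider j ~? ι i))

    N⇒~ : ∀ j {i} → i ∈ˢ N j → outsider j ~ ι i
    N⇒~ j {i} i∈ = invert (subst (Reflects _)
      (trans (sym (lookup∘tabulate _ i)) ([]=⇒lookup i∈)) (proof (outsider j ~? ι i)))

    ~⇒N : ∀ j {i} → outsider j ~ ι i → i ∈ˢ N j
    ~⇒N j {i} o~i = lookup⇒[]= i (N j) (trans (lookup∘tabulate _ i) (dec-true (outsider j ~? ι i) o~i))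

    N-nonempty : ∀ j → Nonempty (N j)
    N-nonempty j with i , o~i ← attached (outsider-outside j) = i , ~⇒N j o~i

    N⊆U : ∀ j → N j ⊆ˢ U
    N⊆U j i∈ = attached-U (outsider-outside j) (N⇒~ j i∈)

    H : Graph (Fin order ⊎ Fin (length outsiders))
    H = extend (fromEdges (required ++ chosen)) N

    place : Fin order ⊎ Fin (length outsiders) → Fin n
    place = [ ι , outsider ]′

    place-injective : ∀ {x y} → place x ≡ place y → x ≡ y
    place-injective {inj₁ i} {inj₁ j} eq = cong inj₁ (ι-injective eq)
    place-injective {inj₁ i} {inj₂ j} eq = contradiction (sym eq) (outsider-outside j i)
    place-injective {inj₂ i} {inj₁ j} eq = contradiction eq (outsider-outside i j)
    place-injective {inj₂ i} {inj₂ j} eq =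
      cong inj₂ (lookup-injective (filter⁺ outside? (allFin⁺ n)) eq)

    place-surjective : ∀ w → ∃ λ x → place x ≡ w
    place-surjective w with image⊎outside w
    ... | inj₁ (i , ιi≡w) = inj₁ i , ιi≡w
    ... | inj₂ w-out = inj₂ (index w∈) , sym (lookup-index w∈)
      where w∈ = ∈-filter⁺ outside? (∈-allFin w) w-out

    bij : (Fin order ⊎ Fin (length outsiders)) ↔ Fin n
    bij = ⤖⇒↔ (mk⤖ (place-injective ,
      λ w → proj₁ (place-surjective w) , λ { refl → proj₂ (place-surjective w) }))

    base⇒ : ∀ {i j} → (i , j) ∈ required ++ chosen → ι i ~ ι j
    base⇒ ij = [ adj-required , proj₂ ∘ ∈-filter⁻ chosen? {xs = optional} ]′ (∈-++⁻ required ij)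

    base⇐ : ∀ {i j} → ι i ~ ι j → (i , j) ∈ required ++ optional → (i , j) ∈ required ++ chosen
    base⇐ i~j ij =
      [ ∈-++⁺ˡ , (λ ij∈ → ∈-++⁺ʳ required (∈-filter⁺ chosen? ij∈ i~j)) ]′ (∈-++⁻ required ij)

    place-adj : ∀ x y → place x ~ place y ⇔ Graph._~_ H x y
    place-adj (inj₁ i) (inj₁ j) = mk⇔
      (λ i~j → ~⇒≢ G i~j ∘ cong ι , Sum.map (base⇐ i~j) (base⇐ (~-sym i~j)) (adj-listed i~j))
      ([ base⇒ , ~-sym ∘ base⇒ ]′ ∘ proj₂)
    place-adj (inj₁ i) (inj₂ j) = mk⇔ (~⇒N j ∘ ~-sym) (~-sym ∘ N⇒~ j)
    place-adj (inj₂ i) (inj₁ j) = mk⇔ (~⇒N i) (N⇒~ i)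
    place-adj (inj₂ i) (inj₂ j) =
      mk⇔ (independent (outsider-outside i) (outsider-outside j)) ⊥-elim

    adjacency : ∀ u v → u ~ v ⇔ Graph._~_ H (Inverse.from bij u) (Inverse.from bij v)
    -- Every vertex is the place of its preimage under `bij`, so `place-adj` covers all pairs.
    adjacency u v = subst₂ (λ u′ v′ → u′ ~ v′ ⇔ Graph._~_ H (Inverse.from bij u) (Inverse.from bij v))
      (Inverse.strictlyInverseˡ bij u) (Inverse.strictlyInverseˡ bij v)
      (place-adj (Inverse.from bij u) (Inverse.from bij v))

-- From membership in a family to a presentation.

module _ {F : Family} {n : ℕ} {G : Graph (Fin n)} where
  open Family F
  open Graph G

  -- `fromEdges` discards loops, so a required pair yields an edge only if its ends differ.
  ∈ᶠ⇒presentation : All (λ p → proj₁ p ≢ proj₂ p) required → G ∈ᶠ F → Presentation F G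
  ∈ᶠ⇒presentation loopless (chosen , chosen⊆ , m , N , N-ok , iso) = record
    { ι            = ι
    ; ι-injective  = λ {i} {j} eq → inj₁-injective
        (trans (sym (to-from (inj₁ i))) (trans (cong to eq) (to-from (inj₁ j))))
    ; adj-required = adj-required
    ; adj-listed   = adj-listed
    ; independent  = independent
    ; attached-U   = attached-U
    ; attached     = attached
    }
    where
    open _≅_ iso
    open Inverse bijection using (to; from) renaming (strictlyInverseˡ to to-from; strictlyInverseʳ to from-to)

    H : Graph (Fin order ⊎ Fin m)
    H = extend (fromEdges (required ++ chosen)) N

    ι : Fin order → Fin n
    ι i = from (inj₁ i)

    Outside : Fin n → Set
    Outside w = ∀ i → w ≢ ι i

    ι-adj : ∀ i j → ι i ~ ι j ⇔ Graph._~_ H (inj₁ i) (inj₁ j)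
    ι-adj i j = subst₂ (λ x y → ι i ~ ι j ⇔ Graph._~_ H x y)
      (to-from (inj₁ i)) (to-from (inj₁ j)) (adjacency (ι i) (ι j))

    new : ∀ {w} → Outside w → ∃ λ j → to w ≡ inj₂ j
    new {w} out with to w in eq
    ... | inj₁ i = contradiction (trans (sym (from-to w)) (cong from eq)) (out i)
    ... | inj₂ j = j , refl

    adj-new : ∀ {w j} → to w ≡ inj₂ j → ∀ i → w ~ ι i ⇔ i ∈ˢ N j
    adj-new {w} w≡j i = subst₂ (λ x y → w ~ ι i ⇔ Graph._~_ H x y)
      w≡j (to-from (inj₁ i)) (adjacency w (ι i))

    adj-required : ∀ {i j} → (i , j) ∈ required → ι i ~ ι j
    adj-required {i} {j} ij =
      Equivalence.from (ι-adj i j) (All.lookup loopless ij , inj₁ (∈-++⁺ˡ ij))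

    adj-listed : ∀ {i j} → ι i ~ ι j → Listed F (i , j)
    adj-listed {i} {j} i~j = Sum.map listed listed (proj₂ (Equivalence.to (ι-adj i j) i~j))
      where
      listed : ∀ {p} → p ∈ required ++ chosen → p ∈ required ++ optional
      listed p∈ = [ ∈-++⁺ˡ , ∈-++⁺ʳ required ∘ chosen⊆ ]′ (∈-++⁻ required p∈)

    independent : ∀ {w w′} → Outside w → Outside w′ → ¬ (w ~ w′)
    independent {w} {w′} out out′ w~w′ with j , w≡ ← new out | j′ , w′≡ ← new out′ =
      subst₂ (Graph._~_ H) w≡ w′≡ (Equivalence.to (adjacency w w′) w~w′)

    attached-U : ∀ {w i} → Outside w → w ~ ι i → i ∈ˢ U
    attached-U {w} {i} out w~i with j , w≡ ← new out =
      proj₂ (N-ok j) (Equivalence.to (adj-new w≡ i) w~i)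

    attached : ∀ {w} → Outside w → ∃ λ i → w ~ ι i
    attached {w} out with j , w≡ ← new out with (i , i∈N) , _ ← N-ok j =
      i , Equivalence.from (adj-new w≡ i) i∈N

-- Sufficiency, by computation on traces.

certified⇒connectedGraph : ∀ {F n} {G : Graph (Fin n)} k root → Presentation F G →
  root ∈ Family.required F → TracesReach F k root → NoThreeTraces F →
  IsConnectedGraph (MatchingComplex G)
certified⇒connectedGraph k root pres root∈ reach no3 =
  noThreeMatching⇒dimension (presentation⇒noThreeMatching pres no3) ,
  presentation⇒connected pres k root∈ reach

loopless? : ∀ F → Dec (All (λ p → proj₁ p ≢ proj₂ p) (Family.required F))
loopless? F = All.all? (λ p → ¬? (proj₁ p ≟ proj₂ p)) _

∈𝒢₁⇒connectedGraph : ∀ {n} {G : Graph (Fin n)} → G ∈ᶠ 𝒢₁ → IsConnectedGraph (MatchingComplex G)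
-- The bound 2 allows three steps, as the chord 14 needs: 14, 23, 45, 12.
∈𝒢₁⇒connectedGraph G∈ = certified⇒connectedGraph 2 (v₁ , v₂)
  (∈ᶠ⇒presentation (from-yes (loopless? 𝒢₁)) G∈) (here refl)
  (from-yes (tracesReach? 𝒢₁ 2 (v₁ , v₂))) (from-yes (noThreeTraces? 𝒢₁))

∈𝒢₂⇒connectedGraph : ∀ {n} {G : Graph (Fin n)} → G ∈ᶠ 𝒢₂ → IsConnectedGraph (MatchingComplex G)
∈𝒢₂⇒connectedGraph G∈ = certified⇒connectedGraph 2 (v₁ , v₂)
  (∈ᶠ⇒presentation (from-yes (loopless? 𝒢₂)) G∈) (here refl)
  (from-yes (tracesReach? 𝒢₂ 2 (v₁ , v₂))) (from-yes (noThreeTraces? 𝒢₂))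

∈𝒢₃⇒connectedGraph : ∀ {n} {G : Graph (Fin n)} → G ∈ᶠ 𝒢₃ → IsConnectedGraph (MatchingComplex G)
∈𝒢₃⇒connectedGraph G∈ = certified⇒connectedGraph 3 (v₁ , v₂)
  (∈ᶠ⇒presentation (from-yes (loopless? 𝒢₃)) G∈) (here refl)
  (from-yes (tracesReach? 𝒢₃ 3 (v₁ , v₂))) (from-yes (noThreeTraces? 𝒢₃))

-- The bowtie as a family with a single member up to isomorphism.
ℬ : Family
ℬ = record
  { order    = 5
  ; required = (v₁ , v₂) ∷ (v₂ , v₃) ∷ (v₁ , v₃) ∷ (v₃ , v₄) ∷ (v₄ , v₅) ∷ (v₃ , v₅) ∷ []
  ; optional = []
  ; U        = ∅
  }

≅bowtie⇒∈ℬ : ∀ {n} {G : Graph (Fin n)} → G ≅ bowtie → G ∈ᶠ ℬ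
≅bowtie⇒∈ℬ iso = [] , id , 0 , (λ ()) , (λ ()) , record
  { bijection = mk↔ₛ′ (inj₁ ∘ to) [ from , (λ ()) ]′
      (λ { (inj₁ i) → cong inj₁ (strictlyInverseˡ i) ; (inj₂ ()) }) strictlyInverseʳ
  ; adjacency = adjacency
  }
  where
  open _≅_ iso
  open Inverse bijection using (to; from; strictlyInverseˡ; strictlyInverseʳ)

-- A new vertex would have a neighbour in the empty `U`, and there is no optional edge to choose.
∈ℬ⇒≅bowtie : ∀ {n} {G : Graph (Fin n)} → G ∈ᶠ ℬ → G ≅ bowtie
∈ℬ⇒≅bowtie (chosen , chosen⊆ , suc m , N , N-ok , iso) with (i , i∈N) , N⊆∅ ← N-ok zero =
  contradiction (N⊆∅ i∈N) ∉⊥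
∈ℬ⇒≅bowtie (_ ∷ _ , chosen⊆ , _) with () ← chosen⊆ (here refl)
∈ℬ⇒≅bowtie {G = G} ([] , _ , zero , N , _ , iso) = record
  { bijection = mk↔ₛ′ (old ∘ to) (from ∘ inj₁)
      (λ i → cong old (strictlyInverseˡ (inj₁ i)))
      (λ v → trans (cong from (inj₁-old (to v))) (strictlyInverseʳ v))
  ; adjacency = λ u v → subst₂ (λ x y → Graph._~_ G u v ⇔ ExtAdj bowtie N x y)
      (sym (inj₁-old (to u))) (sym (inj₁-old (to v))) (adjacency u v)
  }
  where
  open _≅_ iso
  open Inverse bijection using (to; from; strictlyInverseˡ; strictlyInverseʳ)

  old : Fin 5 ⊎ Fin 0 → Fin 5
  old (inj₁ i) = i

  inj₁-old : ∀ x → inj₁ (old x) ≡ x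
  inj₁-old (inj₁ _) = refl

≅bowtie⇒connectedGraph : ∀ {n} {G : Graph (Fin n)} → G ≅ bowtie → IsConnectedGraph (MatchingComplex G)
≅bowtie⇒connectedGraph iso = certified⇒connectedGraph 3 (v₁ , v₂)
  (∈ᶠ⇒presentation (from-yes (loopless? ℬ)) (≅bowtie⇒∈ℬ iso)) (here refl)
  (from-yes (tracesReach? ℬ 3 (v₁ , v₂))) (from-yes (noThreeTraces? ℬ))

record FivePath {n : ℕ} (G : Graph (Fin n)) : Set where
  open Graph G
  field
    ι           : Fin 5 → Fin n
    ι-injective : ∀ {i j} → ι i ≡ ι j → i ≡ j
    ι₀~ι₁       : ι 0F ~ ι 1F
    ι₁~ι₂       : ι 1F ~ ι 2F
    ι₂~ι₃       : ι 2F ~ ι 3F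
    ι₃~ι₄       : ι 3F ~ ι 4F

-- Existence of a path on five vertices.

module _ {n : ℕ} {G : Graph (Fin n)} where
  open Graph G

  fivePath : ∀ {a b c d e} → a ~ b → b ~ c → c ~ d → d ~ e →
    a ≢ c → a ≢ d → a ≢ e → b ≢ d → b ≢ e → c ≢ e → FivePath G
  fivePath {a} {b} {c} {d} {e} a~b b~c c~d d~e a≢c a≢d a≢e b≢d b≢e c≢e = record
    { ι           = lookup (a ∷ b ∷ c ∷ d ∷ e ∷ [])
    ; ι-injective = vec-lookup-injective
        ( (~⇒≢ G a~b ∷ a≢c ∷ a≢d ∷ a≢e ∷ []) VecPairs.∷
          (~⇒≢ G b~c ∷ b≢d ∷ b≢e ∷ []) VecPairs.∷
          (~⇒≢ G c~d ∷ c≢e ∷ []) VecPairs.∷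
          (~⇒≢ G d~e ∷ []) VecPairs.∷ [] VecPairs.∷ VecPairs.[]) _ _
    ; ι₀~ι₁ = a~b ; ι₁~ι₂ = b~c ; ι₂~ι₃ = c~d ; ι₃~ι₄ = d~e
    }

  record FourPath : Set where
    field
      {a b c d} : Fin n
      a~b : a ~ b
      b~c : b ~ c
      c~d : c ~ d
      a≢c : a ≢ c
      a≢d : a ≢ d
      b≢d : b ≢ d

  opposite : ∀ {p v} → Adj G p → v ∈ₑ p → ∃ λ u → u ∈ₑ p × u ~ v
  opposite p~ (inj₁ refl) = _ , inj₂ refl , ~-sym p~
  opposite p~ (inj₂ refl) = _ , inj₁ refl , p~

  disjoint⇒≢ₑ : ∀ {p q : Fin n × Fin n} {u v} → Disjoint p q → u ∈ₑ p → v ∈ₑ q → u ≢ v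
  disjoint⇒≢ₑ dis u∈p v∈q refl = dis u∈p v∈q

  ∉⇒≢ : ∀ {p : Fin n × Fin n} {u w} → u ∈ₑ p → ¬ w ∈ₑ p → u ≢ w
  ∉⇒≢ u∈p w∉p refl = w∉p u∈p

  avoids⇒disjoint : ∀ {x y} {p : Fin n × Fin n} → ¬ x ∈ₑ p → ¬ y ∈ₑ p → Disjoint (x , y) p
  avoids⇒disjoint x∉p y∉p (inj₁ refl) = x∉p
  avoids⇒disjoint x∉p y∉p (inj₂ refl) = y∉p

  module _ (no3 : NoThreeMatching G) where

    -- Induction on a walk from `p` to `q`, whose current vertex is on `p`, or off both edges and
    -- adjacent to `p`. Two consecutive vertices off both would give a three-matching, so `q` is
    -- entered from `p` directly or through a single vertex.
    linkingPath : ∀ {p q} → Adj G p → Adj G q → Disjoint p q →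
      ∀ {u t} → Star _~_ u t → t ∈ₑ q →
      u ∈ₑ p ⊎ (¬ u ∈ₑ p × ¬ u ∈ₑ q × ∃ λ x → x ∈ₑ p × x ~ u) →
      FourPath ⊎ FivePath G
    linkingPath p~ q~ dis ε t∈q (inj₁ t∈p) = ⊥-elim (dis t∈p t∈q)
    linkingPath p~ q~ dis ε t∈q (inj₂ (_ , t∉q , _)) = contradiction t∈q t∉q
    linkingPath {p} {q} p~ q~ dis (_◅_ {u} {w} u~w path) t∈q state with w ∈ₑ? p | w ∈ₑ? q
    ... | yes w∈p | _ = linkingPath p~ q~ dis path t∈q (inj₁ w∈p)
    linkingPath {p} {q} p~ q~ dis (_◅_ {u} {w} u~w path) t∈q (inj₁ u∈p) | no w∉p | no w∉q =
      linkingPath p~ q~ dis path t∈q (inj₂ (w∉p , w∉q , u , u∈p , u~w))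
    linkingPath {p} {q} p~ q~ dis (_◅_ {u} {w} u~w path) t∈q (inj₁ u∈p) | no w∉p | yes w∈q
      with u′ , u′∈p , u′~u ← opposite p~ u∈p | w′ , w′∈q , w′~w ← opposite q~ w∈q =
      inj₁ (record
        { a~b = u′~u ; b~c = u~w ; c~d = ~-sym w′~w
        ; a≢c = disjoint⇒≢ₑ dis u′∈p w∈q
        ; a≢d = disjoint⇒≢ₑ dis u′∈p w′∈q
        ; b≢d = disjoint⇒≢ₑ dis u∈p w′∈q })
    linkingPath {p} {q} p~ q~ dis (_◅_ {u} {w} u~w path) t∈q (inj₂ (u∉p , u∉q , x , x∈p , x~u))
      | no w∉p | yes w∈q
      with x′ , x′∈p , x′~x ← opposite p~ x∈p | w′ , w′∈q , w′~w ← opposite q~ w∈q =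
      inj₂ (fivePath x′~x x~u u~w (~-sym w′~w)
        (∉⇒≢ x′∈p u∉p) (disjoint⇒≢ₑ dis x′∈p w∈q) (disjoint⇒≢ₑ dis x′∈p w′∈q)
        (disjoint⇒≢ₑ dis x∈p w∈q) (disjoint⇒≢ₑ dis x∈p w′∈q) (≢-sym (∉⇒≢ w′∈q u∉q)))
    linkingPath {p} {q} p~ q~ dis (_◅_ {u} {w} u~w path) t∈q (inj₂ (u∉p , u∉q , _))
      | no w∉p | no w∉q =
      ⊥-elim (no3 u~w p~ q~ (avoids⇒disjoint u∉p w∉p) (avoids⇒disjoint u∉q w∉q) dis)

    -- An edge with exactly one end in {a , d} prolongs the path there.
    beyondMiddle : (path : FourPath) → let open FourPath path in
      ∀ {p} → Adj G p → Disjoint (b , c) p → Same p (a , d) ⊎ FivePath G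
    beyondMiddle path {x , y} x~y dis = cases (x ∈ₑ? (a , d)) (y ∈ₑ? (a , d))
      where
      open FourPath path

      x∉bc : ¬ x ∈ₑ (b , c)
      x∉bc x∈bc = dis x∈bc (inj₁ refl)

      y∉bc : ¬ y ∈ₑ (b , c)
      y∉bc y∈bc = dis y∈bc (inj₂ refl)

      extend-end : ∀ {u w} → u ∈ₑ (a , d) → u ~ w → ¬ w ∈ₑ (a , d) → ¬ w ∈ₑ (b , c) → FivePath G
      extend-end (inj₁ refl) a~w w∉ad w∉bc = fivePath (~-sym a~w) a~b b~c c~d
        (w∉bc ∘ inj₁) (w∉bc ∘ inj₂) (w∉ad ∘ inj₂) a≢c a≢d b≢d
      extend-end (inj₂ refl) d~w w∉ad w∉bc = fivePath (~-sym d~w) (~-sym c~d) (~-sym b~c) (~-sym a~b)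
        (w∉bc ∘ inj₂) (w∉bc ∘ inj₁) (w∉ad ∘ inj₁) (≢-sym b≢d) (≢-sym a≢d) (≢-sym a≢c)

      avoids-ab : ∀ {w} → ¬ w ∈ₑ (a , d) → ¬ w ∈ₑ (b , c) → ¬ w ∈ₑ (a , b)
      avoids-ab w∉ad w∉bc = [ w∉ad ∘ inj₁ , w∉bc ∘ inj₁ ]′

      avoids-cd : ∀ {w} → ¬ w ∈ₑ (a , d) → ¬ w ∈ₑ (b , c) → ¬ w ∈ₑ (c , d)
      avoids-cd w∉ad w∉bc = [ w∉bc ∘ inj₂ , w∉ad ∘ inj₂ ]′

      cases : Dec (x ∈ₑ (a , d)) → Dec (y ∈ₑ (a , d)) → Same (x , y) (a , d) ⊎ FivePath G
      cases (yes (inj₁ refl)) (yes (inj₁ refl)) = contradiction x~y ~-irrefl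
      cases (yes (inj₁ refl)) (yes (inj₂ refl)) = inj₁ (inj₁ refl)
      cases (yes (inj₂ refl)) (yes (inj₁ refl)) = inj₁ (inj₂ refl)
      cases (yes (inj₂ refl)) (yes (inj₂ refl)) = contradiction x~y ~-irrefl
      cases (yes x∈) (no y∉)  = inj₂ (extend-end x∈ x~y y∉ y∉bc)
      cases (no x∉)  (yes y∈) = inj₂ (extend-end y∈ (~-sym x~y) x∉ x∉bc)
      cases (no x∉)  (no y∉)  = ⊥-elim (no3 x~y a~b c~d
        (avoids⇒disjoint (avoids-ab x∉ x∉bc) (avoids-ab y∉ y∉bc))
        (avoids⇒disjoint (avoids-cd x∉ x∉bc) (avoids-cd y∉ y∉bc))
        (avoids⇒disjoint [ a≢c , a≢d ]′ [ ~⇒≢ G b~c , b≢d ]′))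

    module _ (induct : MatchingInduction G) where

      -- Without a five-vertex path, `beyondMiddle` leaves only `ad` disjoint from `bc` and only
      -- `bc` disjoint from an edge `ad`, so induction from `bc` could never arrive at `ab`.
      fourPath⇒fivePath : FourPath → FivePath G
      fourPath⇒fivePath path =
        [ ⊥-elim ∘ ab≉bc , [ ⊥-elim ∘ ab≉ad , id ]′ ]′
          (induct P (Sum.map Same-swap (Sum.map₁ Same-swap)) step b~c (inj₁ (inj₁ refl)) a~b)
        where
        open FourPath path

        P : Fin n × Fin n → Set
        P p = Same p (b , c) ⊎ Same p (a , d) ⊎ FivePath G

        -- The path `c d a b` on the 4-cycle has middle edge `da` and closing pair `cb`, which
        -- exchanges the two roles.
        closed : a ~ d → FourPath
        closed a~d = record
          { a~b = c~d ; b~c = ~-sym a~d ; c~d = a~b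
          ; a≢c = ≢-sym a≢c ; a≢d = ≢-sym (~⇒≢ G b~c) ; b≢d = ≢-sym b≢d }

        step : ∀ {p q} → P p → Adj G p → Adj G q → Disjoint p q → P q
        step (inj₁ p≈bc) p~ q~ dis =
          inj₂ (beyondMiddle path q~ (Disjoint-Same (Same-sym p≈bc) (inj₁ refl) dis))
        step (inj₂ (inj₁ p≈ad)) p~ q~ dis =
          Sum.map (λ q≈cb → Same-trans q≈cb (inj₂ refl)) inj₂
            (beyondMiddle (closed (Adj-Same G (Same-sym p≈ad) p~)) q~
              (Disjoint-Same (Same-trans (inj₂ refl) (Same-sym p≈ad)) (inj₁ refl) dis))
        step (inj₂ (inj₂ five)) _ _ _ = inj₂ (inj₂ five)

        ab≉bc : ¬ Same (a , b) (b , c)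
        ab≉bc (inj₁ refl) = ~-irrefl a~b
        ab≉bc (inj₂ refl) = a≢c refl

        ab≉ad : ¬ Same (a , b) (a , d)
        ab≉ad (inj₁ refl) = b≢d refl
        ab≉ad (inj₂ refl) = a≢d refl

      -- Any two disjoint edges are linked by a path. If there were none, induction from `e` would
      -- never leave `e`, contradicting `e≢f`.
      hasFivePath : Connected G → AtLeastTwoEdges G → FivePath G
      hasFivePath conn (e , f , e≢f) =
        [ ⊥-elim ∘ e≢f ∘ sym ∘ Same-ends , [ fourPath⇒fivePath , id ]′ ]′
          (induct P (Sum.map₁ Same-swap) step (ends-adj e) (inj₁ (inj₁ refl)) (ends-adj f))
        where
        P : Fin n × Fin n → Set
        P p = Same p (ends e) ⊎ (FourPath ⊎ FivePath G)

        step : ∀ {p q} → P p → Adj G p → Adj G q → Disjoint p q → P q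
        step {_ , _} {_ , _} (inj₁ _) p~ q~ dis =
          inj₂ (linkingPath p~ q~ dis (conn _ _) (inj₁ refl) (inj₁ (inj₁ refl)))
        step (inj₂ found) _ _ _ = inj₂ found

-- Classification by the chords of a five-vertex path.

module _ {n : ℕ} {G : Graph (Fin n)} where
  open Graph G

  permuteInjective? : (π : Vec (Fin 5) 5) → Dec (∀ i j → lookup π i ≡ lookup π j → i ≡ j)
  permuteInjective? π = all? λ i → all? λ j → (lookup π i ≟ lookup π j) →-dec (i ≟ j)

  permute : (path : FivePath G) (π : Vec (Fin 5) 5) → {True (permuteInjective? π)} →
    (let ρ = λ i → FivePath.ι path (lookup π i)) →
    ρ 0F ~ ρ 1F → ρ 1F ~ ρ 2F → ρ 2F ~ ρ 3F → ρ 3F ~ ρ 4F → FivePath G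
  permute path π {inj} s₀₁ s₁₂ s₂₃ s₃₄ = record
    { ι           = ι ∘ lookup π
    ; ι-injective = toWitness inj _ _ ∘ ι-injective
    ; ι₀~ι₁ = s₀₁ ; ι₁~ι₂ = s₁₂ ; ι₂~ι₃ = s₂₃ ; ι₃~ι₄ = s₃₄
    }
    where open FivePath path

  module _ (conn : Connected G) (no3 : NoThreeMatching G) where

    module Chords (path : FivePath G) where
      open FivePath path public
      open Image ι public

      -- Disjointness is decided on indices alone, with `(i , i)` standing for the edge to `w`.
      noMatchingWith : ∀ {w i} → Outside w → w ~ ι i → ∀ p q → Adj G (image p) → Adj G (image q) →
        {True (disjoint? (i , i) p)} → {True (disjoint? (i , i) q)} → {True (disjoint? p q)} → ⊥
      noMatchingWith {w} {i} out w~ p q p~ q~ {i⊥p} {i⊥q} {p⊥q} = no3 w~ p~ q~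
        (disjoint-image {t = i , i} {p} (traces-outside ι-injective out) (toWitness i⊥p))
        (disjoint-image {t = i , i} {q} (traces-outside ι-injective out) (toWitness i⊥q))
        (disjoint-image {t = p} {q} (traces-image ι-injective) (toWitness p⊥q))

      -- Such an edge would form a three-matching with the first and third edges of the path.
      outside-independent : ∀ {w w′} → Outside w → Outside w′ → ¬ (w ~ w′)
      outside-independent out out′ w~w′ = no3 w~w′ ι₀~ι₁ ι₂~ι₃
        (avoids⇒disjoint {G = G} (misses out) (misses out′))
        (avoids⇒disjoint {G = G} (misses out) (misses out′))
        (disjoint-image {t = 0F , 1F} {2F , 3F} (traces-image ι-injective)
          (from-yes (disjoint? (0F , 1F) (2F , 3F))))
        where
        misses : ∀ {w} → Outside w → ∀ {i j} → ¬ w ∈ₑ image (i , j)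
        misses out = [ out _ , out _ ]′

      -- The first step of a walk from `w` to the path cannot end outside, by independence.
      outside-attached : ∀ {w} → Outside w → ∃ λ i → w ~ ι i
      outside-attached {w} out with conn w (ι 0F)
      ... | ε = contradiction refl (out 0F)
      ... | _◅_ {j = v} w~v _ with image⊎outside v
      ...   | inj₁ (i , refl) = i , w~v
      ...   | inj₂ v-out = contradiction w~v (outside-independent out v-out)

      module _ {required optional : List (Fin 5 × Fin 5)} {U : Subset 5} where

        family : Family
        family = record { order = 5 ; required = required ; optional = optional ; U = U }

        -- Deleting `0F`, `2F` or `4F` from the path leaves two disjoint path edges, so no outside
        -- vertex attaches there; only `1F` and `3F` depend on the family.
        present : All (Adj G ∘ image) required → All (¬_ ∘ Adj G ∘ image) (forbidden family) →
          (∀ {w} → Outside w → w ~ ι 1F → 1F ∈ˢ U) →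
          (∀ {w} → Outside w → w ~ ι 3F → 3F ∈ˢ U) →
          Presentation family G
        present req forb U₁ U₃ = record
          { ι            = ι
          ; ι-injective  = ι-injective
          ; adj-required = All.lookup req
          ; adj-listed   = listed
          ; independent  = outside-independent
          ; attached-U   = attached-U
          ; attached     = outside-attached
          }
          where
          listed : ∀ {i j} → ι i ~ ι j → Listed family (i , j)
          listed {i} {j} i~j with <-cmp i j
          ... | tri< i<j _ _ =
            [ id , (λ ij∈ → contradiction i~j (All.lookup forb ij∈)) ]′ (listed⊎forbidden family i<j)
          ... | tri≈ _ refl _ = contradiction i~j ~-irrefl
          ... | tri> _ _ j<i =
            [ Sum.swap , (λ ji∈ → contradiction (~-sym i~j) (All.lookup forb ji∈)) ]′
              (listed⊎forbidden family j<i)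

          attached-U : ∀ {w i} → Outside w → w ~ ι i → i ∈ˢ U
          attached-U {i = 0F} out w~ = ⊥-elim (noMatchingWith out w~ (1F , 2F) (3F , 4F) ι₁~ι₂ ι₃~ι₄)
          attached-U {i = 1F} out w~ = U₁ out w~
          attached-U {i = 2F} out w~ = ⊥-elim (noMatchingWith out w~ (0F , 1F) (3F , 4F) ι₀~ι₁ ι₃~ι₄)
          attached-U {i = 3F} out w~ = U₃ out w~
          attached-U {i = 4F} out w~ = ⊥-elim (noMatchingWith out w~ (0F , 1F) (2F , 3F) ι₀~ι₁ ι₂~ι₃)

    open FivePath

    -- Each vertex of a 5-cycle misses two disjoint cycle edges, so nothing attaches outside; every
    -- chord is optional, so `forbidden` is empty.
    fiveCycle⇒𝒢₃ : (path : FivePath G) → ι path 4F ~ ι path 0F → Presentation 𝒢₃ G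
    fiveCycle⇒𝒢₃ path ι₄~ι₀ = C.present
      (C.ι₀~ι₁ ∷ C.ι₁~ι₂ ∷ C.ι₂~ι₃ ∷ C.ι₃~ι₄ ∷ ι₄~ι₀ ∷ []) []
      (λ out w~ → ⊥-elim (C.noMatchingWith out w~ (2F , 3F) (4F , 0F) C.ι₂~ι₃ ι₄~ι₀))
      (λ out w~ → ⊥-elim (C.noMatchingWith out w~ (1F , 2F) (4F , 0F) C.ι₁~ι₂ ι₄~ι₀))
      where
      module C = Chords path

    reverse : FivePath G → FivePath G
    reverse path = permute path (4F ∷ 3F ∷ 2F ∷ 1F ∷ 0F ∷ [])
      (~-sym (ι₃~ι₄ path)) (~-sym (ι₂~ι₃ path)) (~-sym (ι₁~ι₂ path)) (~-sym (ι₀~ι₁ path))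

    -- The chord from `1F` to `4F` would close the 5-cycle 4, 3, 2, 0, 1. Otherwise the chords from
    -- `3F` to `0F` and `1F` are the optional edges of `𝒢₂`.
    triangle⇒𝒢₂⊎𝒢₃ : (path : FivePath G) → ι path 0F ~ ι path 2F → ¬ ι path 2F ~ ι path 4F →
      ¬ ι path 0F ~ ι path 4F → Presentation 𝒢₂ G ⊎ Presentation 𝒢₃ G
    triangle⇒𝒢₂⊎𝒢₃ path ι₀~ι₂ ι₂≁ι₄ ι₀≁ι₄ with ι path 1F ~? ι path 4F
    ... | yes ι₁~ι₄ = inj₂ (fiveCycle⇒𝒢₃
      (permute path (4F ∷ 3F ∷ 2F ∷ 0F ∷ 1F ∷ [])
        (~-sym (ι₃~ι₄ path)) (~-sym (ι₂~ι₃ path)) (~-sym ι₀~ι₂) (ι₀~ι₁ path))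
      ι₁~ι₄)
    ... | no ι₁≁ι₄ = inj₁ (C.present
      (C.ι₀~ι₁ ∷ C.ι₁~ι₂ ∷ ι₀~ι₂ ∷ C.ι₂~ι₃ ∷ C.ι₃~ι₄ ∷ [])
      (ι₀≁ι₄ ∷ ι₁≁ι₄ ∷ ι₂≁ι₄ ∷ [])
      (λ out w~ → ⊥-elim (C.noMatchingWith out w~ (0F , 2F) (3F , 4F) ι₀~ι₂ C.ι₃~ι₄))
      (λ _ _ → from-yes (3F ∈ˢ? Family.U 𝒢₂)))
      where
      module C = Chords path

    -- The triangles share `2F`; any edge between their other vertices closes a 5-cycle, and without
    -- one they form the bowtie.
    twoTriangles⇒ℬ⊎𝒢₃ : (path : FivePath G) → ι path 0F ~ ι path 2F → ι path 2F ~ ι path 4F →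
      ¬ ι path 0F ~ ι path 4F → Presentation 𝒢₃ G ⊎ Presentation ℬ G
    twoTriangles⇒ℬ⊎𝒢₃ path ι₀~ι₂ ι₂~ι₄ ι₀≁ι₄
      with ι path 0F ~? ι path 3F | ι path 1F ~? ι path 3F | ι path 1F ~? ι path 4F
    ... | yes ι₀~ι₃ | _ | _ = inj₁ (fiveCycle⇒𝒢₃
      (permute path (0F ∷ 1F ∷ 2F ∷ 4F ∷ 3F ∷ [])
        (ι₀~ι₁ path) (ι₁~ι₂ path) ι₂~ι₄ (~-sym (ι₃~ι₄ path)))
      (~-sym ι₀~ι₃))
    ... | no _ | yes ι₁~ι₃ | _ = inj₁ (fiveCycle⇒𝒢₃
      (permute path (0F ∷ 1F ∷ 3F ∷ 4F ∷ 2F ∷ [])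
        (ι₀~ι₁ path) ι₁~ι₃ (ι₃~ι₄ path) (~-sym ι₂~ι₄))
      (~-sym ι₀~ι₂))
    ... | no _ | no _ | yes ι₁~ι₄ = inj₁ (fiveCycle⇒𝒢₃
      (permute path (4F ∷ 3F ∷ 2F ∷ 0F ∷ 1F ∷ [])
        (~-sym (ι₃~ι₄ path)) (~-sym (ι₂~ι₃ path)) (~-sym ι₀~ι₂) (ι₀~ι₁ path))
      ι₁~ι₄)
    ... | no ι₀≁ι₃ | no ι₁≁ι₃ | no ι₁≁ι₄ = inj₂ (C.present
      (C.ι₀~ι₁ ∷ C.ι₁~ι₂ ∷ ι₀~ι₂ ∷ C.ι₂~ι₃ ∷ C.ι₃~ι₄ ∷ ι₂~ι₄ ∷ [])
      (ι₀≁ι₃ ∷ ι₀≁ι₄ ∷ ι₁≁ι₃ ∷ ι₁≁ι₄ ∷ [])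
      (λ out w~ → ⊥-elim (C.noMatchingWith out w~ (0F , 2F) (3F , 4F) ι₀~ι₂ C.ι₃~ι₄))
      (λ out w~ → ⊥-elim (C.noMatchingWith out w~ (2F , 4F) (0F , 1F) ι₂~ι₄ C.ι₀~ι₁)))
      where
      module C = Chords path

    -- Every edge of a member meets v₂v₄, which is then isolated in M(G).
    𝒢₁⁺ : Family
    𝒢₁⁺ = record 𝒢₁ { required = (v₂ , v₄) ∷ Family.required 𝒢₁ }

    -- The vertices `0F`, `2F`, `4F` are pairwise non-adjacent and outside vertices attach only to
    -- `1F` and `3F`. So if these two are adjacent, no edge is disjoint from theirs, and induction
    -- from it cannot reach the first path edge.
    chordless⇒𝒢₁ : MatchingInduction G → (path : FivePath G) → ¬ ι path 0F ~ ι path 2F →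
      ¬ ι path 2F ~ ι path 4F → ¬ ι path 0F ~ ι path 4F → Presentation 𝒢₁ G
    chordless⇒𝒢₁ induct path ι₀≁ι₂ ι₂≁ι₄ ι₀≁ι₄ with ι path 1F ~? ι path 3F
    ... | no ι₁≁ι₃ = C.present
      (C.ι₀~ι₁ ∷ C.ι₁~ι₂ ∷ C.ι₂~ι₃ ∷ C.ι₃~ι₄ ∷ [])
      (ι₀≁ι₂ ∷ ι₀≁ι₄ ∷ ι₁≁ι₃ ∷ ι₂≁ι₄ ∷ [])
      (λ _ _ → from-yes (1F ∈ˢ? Family.U 𝒢₁)) (λ _ _ → from-yes (3F ∈ˢ? Family.U 𝒢₁))
      where
      module C = Chords path
    ... | yes ι₁~ι₃ = ⊥-elim (ι₀ι₁≉ι₁ι₃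
      (induct (λ p → Same p (C.image (1F , 3F))) Same-swap
        (λ p≈ _ q~ dis → ⊥-elim (isolated q~ (Disjoint-Same (inj₁ refl) (Same-sym p≈)
          (Disjoint-sym dis))))
        ι₁~ι₃ (inj₁ refl) C.ι₀~ι₁))
      where
      module C = Chords path

      pres : Presentation 𝒢₁⁺ G
      pres = C.present
        (ι₁~ι₃ ∷ C.ι₀~ι₁ ∷ C.ι₁~ι₂ ∷ C.ι₂~ι₃ ∷ C.ι₃~ι₄ ∷ [])
        (ι₀≁ι₂ ∷ ι₀≁ι₄ ∷ ι₂≁ι₄ ∷ [])
        (λ _ _ → from-yes (1F ∈ˢ? Family.U 𝒢₁)) (λ _ _ → from-yes (3F ∈ˢ? Family.U 𝒢₁))

      isolated : ∀ {q} → Adj G q → ¬ Disjoint q (C.image (1F , 3F))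
      isolated q~ dis with t , t∈ , qt ← edge-trace pres q~ =
        All.lookup (from-yes (All.all? (λ t → ¬? (disjoint? t (1F , 3F))) (traces 𝒢₁⁺))) t∈
          (C.traces-disjoint {t = t} {1F , 3F} qt (C.traces-image C.ι-injective) dis)

      ι₀ι₁≉ι₁ι₃ : ¬ Same (C.image (0F , 1F)) (C.image (1F , 3F))
      ι₀ι₁≉ι₁ι₃ (inj₁ eq) with () ← C.ι-injective (cong proj₁ eq)
      ι₀ι₁≉ι₁ι₃ (inj₂ eq) with () ← C.ι-injective (cong proj₁ eq)

    fivePath⇒presentation : MatchingInduction G → FivePath G →
      Presentation 𝒢₁ G ⊎ Presentation 𝒢₂ G ⊎ Presentation 𝒢₃ G ⊎ Presentation ℬ G
    fivePath⇒presentation induct path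
      with ι path 0F ~? ι path 4F | ι path 0F ~? ι path 2F | ι path 2F ~? ι path 4F
    ... | yes ι₀~ι₄ | _ | _ = inj₂ (inj₂ (inj₁ (fiveCycle⇒𝒢₃ path (~-sym ι₀~ι₄))))
    ... | no ι₀≁ι₄ | yes ι₀~ι₂ | yes ι₂~ι₄ =
      inj₂ (inj₂ (twoTriangles⇒ℬ⊎𝒢₃ path ι₀~ι₂ ι₂~ι₄ ι₀≁ι₄))
    ... | no ι₀≁ι₄ | yes ι₀~ι₂ | no ι₂≁ι₄ =
      inj₂ (Sum.map₂ inj₁ (triangle⇒𝒢₂⊎𝒢₃ path ι₀~ι₂ ι₂≁ι₄ ι₀≁ι₄))
    ... | no ι₀≁ι₄ | no ι₀≁ι₂ | yes ι₂~ι₄ =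
      -- Reversal exchanges `0F` with `4F`, moving the triangle to the start of the path.
      inj₂ (Sum.map₂ inj₁ (triangle⇒𝒢₂⊎𝒢₃ (reverse path) (~-sym ι₂~ι₄) (ι₀≁ι₂ ∘ ~-sym) (ι₀≁ι₄ ∘ ~-sym)))
    ... | no ι₀≁ι₄ | no ι₀≁ι₂ | no ι₂≁ι₄ =
      inj₁ (chordless⇒𝒢₁ induct path ι₀≁ι₂ ι₂≁ι₄ ι₀≁ι₄)

lemma3p6 : ∀ (n : ℕ) (G : Graph (Fin n)) → Connected G → AtLeastTwoEdges G →
    IsConnectedGraph (MatchingComplex G) ⇔ (G ∈ᶠ 𝒢₁ ⊎ G ∈ᶠ 𝒢₂ ⊎ G ∈ᶠ 𝒢₃ ⊎ G ≅ bowtie)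
lemma3p6 n G conn twoEdges = mk⇔ classify
  [ ∈𝒢₁⇒connectedGraph , [ ∈𝒢₂⇒connectedGraph , [ ∈𝒢₃⇒connectedGraph , ≅bowtie⇒connectedGraph ]′ ]′ ]′
  where
  classify : IsConnectedGraph (MatchingComplex G) → G ∈ᶠ 𝒢₁ ⊎ G ∈ᶠ 𝒢₂ ⊎ G ∈ᶠ 𝒢₃ ⊎ G ≅ bowtie
  classify (dim , M-conn) =
    Sum.map presentation⇒∈ᶠ (Sum.map presentation⇒∈ᶠ (Sum.map presentation⇒∈ᶠ (∈ℬ⇒≅bowtie ∘ presentation⇒∈ᶠ)))
      (fivePath⇒presentation conn no3 induct (hasFivePath no3 induct conn twoEdges))
    where
    no3    = dimension⇒noThreeMatching dim
    induct = connected⇒matchingInduction M-conn
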